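{- Let $m$ be a positive integer, let $K$ be an integer with $0\le K\le m-1$, and let $a_1,a_2$ be non-negative integers. Then $$\begin{aligned}S_m(\{a_1,a_2\},K)={}&\left(\left\lfloor\frac{a_1+a_2}{m}\right\rfloor-\left\lfloor\frac{a_1}{m}\right\rfloor-\left\lfloor\frac{a_2}{m}\right\rfloor\right)(K+1)\\&+\max\bigl(0,\,((a_1+a_2)\bmod m)+K-m+1\bigr)\\&-\max\bigl(0,\,(a_1\bmod m)+K-m+1\bigr)\\&-\max\bigl(0,\,(a_2\bmod m)+K-m+1\bigr).\end{aligned}$$
   Context: For a positive integer $m$ and non-negative integers $a_1,a_2,K$ (with $a_1=a_2$ allowed; $\{a_1,a_2\}$ is just a list of parameters), define $$S_m(\{a_1,a_2\},K)=\sum_{k=0}^K\left(\left\lfloor\frac{a_1+a_2+k}{m}\right\rfloor-\left\lfloor\frac{a_1+k}{m}\right\rfloor-\left\lfloor\frac{a_2+k}{m}\right\rfloor+\left\lfloor\frac{k}{m}\right\rfloor\right).$$ For an integer $a$, $(a \bmod m)$ denotes the minimal non-negative representative of the class of $a$ in $\mathbb{Z}/m$, i.e. the integer in $\{0,\dots,m-1\}$ congruent to $a$ modulo $m$. -}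

module Defs where

open import Data.Fin using (toℕ)
open import Data.Integer using (ℤ; +_; _+_; _-_)
open import Data.Integer.Properties using (+-0-commutativeMonoid)
open import Data.Nat as ℕ using (ℕ; suc; NonZero; _/_)
open import Algebra.Properties.CommutativeMonoid.Sum +-0-commutativeMonoid using (sum)

-- The index i : Fin (suc K) represents k = 0, …, K.  On naturals, _/_ is the
-- floor of the quotient; the terms are combined in ℤ so that the differences
-- are not truncated.
S : (m : ℕ) .{{_ : NonZero m}} → (a₁ a₂ K : ℕ) → ℤ
S m a₁ a₂ K = sum {suc K} λ i → let k = toℕ i in
  + ((a₁ ℕ.+ a₂ ℕ.+ k) / m) - + ((a₁ ℕ.+ k) / m) - + ((a₂ ℕ.+ k) / m) + + (k / m)

{-# OPTIONS --safe #-}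
-- Write a = q m + r with 0 ≤ r < m.  For 0 ≤ k < m the floor of (a + k) / m is
-- q, plus 1 exactly when r + k ≥ m, so the sum of the first n ≤ m such floors is
-- q n plus the excess max(0, r + n - m).  Since k / m vanishes for k < m, the
-- proposition combines the three remaining floor sums at n = K + 1.
module Submission where

open import Defs
import Data.Integer.Properties as ℤ
open import Algebra.Properties.CommutativeMonoid.Sum ℤ.+-0-commutativeMonoid using (sum)
open import Data.Fin using (toℕ)
open import Data.Integer using (ℤ; +_; _+_; _-_; _*_; _⊔_; _⊖_; 0ℤ; 1ℤ)
import Data.Integer.Tactic.RingSolver as ℤ-Solver
open import Data.Nat as ℕ using (ℕ; zero; suc; NonZero; _/_; _%_; _∸_; _≤_; _<_; z≤n; s≤s)
open import Data.Nat.Divisibility using (n∣m*n)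
open import Data.Nat.DivMod
open import Data.Nat.Properties
import Data.Nat.Tactic.RingSolver as ℕ-Solver
open import Data.Sum using (inj₁; inj₂)
open import Relation.Binary.PropositionalEquality using (_≡_; refl; sym; trans; cong; cong₂; subst; module ≡-Reasoning)
open ≡-Reasoning

-- Reduces a closed form `F` for partial sums to its one-step recurrence. `sum` unfolds at its first
-- term, so the induction absorbs `f 0` into `F 0` and shifts both functions by one.
sum-telescope : ∀ n (F f : ℕ → ℤ) → (∀ k → k < n → F k + f k ≡ F (suc k)) →
  F 0 + sum {n} (λ i → f (toℕ i)) ≡ F n
sum-telescope zero    F f step = ℤ.+-identityʳ (F 0)
sum-telescope (suc n) F f step = begin
  F 0 + (f 0 + rest) ≡⟨ ℤ.+-assoc (F 0) (f 0) rest ⟨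
  (F 0 + f 0) + rest ≡⟨ cong (_+ rest) (step 0 (s≤s z≤n)) ⟩
  F 1 + rest         ≡⟨ sum-telescope n (λ k → F (suc k)) (λ k → f (suc k)) (λ k k<n → step (suc k) (s≤s k<n)) ⟩
  F (suc n)          ∎
  where rest = sum {n} (λ i → f (suc (toℕ i)))

[m+kn]/n≡k : ∀ {m} k n .{{_ : NonZero n}} → m < n → (m ℕ.+ k ℕ.* n) / n ≡ k
[m+kn]/n≡k {m} k n m<n = begin
  (m ℕ.+ k ℕ.* n) / n     ≡⟨ +-distrib-/-∣ʳ m (n∣m*n k) ⟩
  m / n ℕ.+ k ℕ.* n / n   ≡⟨ cong₂ ℕ._+_ (m<n⇒m/n≡0 m<n) (m*n/n≡m k n) ⟩
  k                       ∎

-- The candidate closed form for the sum of `(a + k) / m` over `k < n`, where `n ≤ m`; truncated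
-- subtraction supplies the maximum with 0.
floorSum : (m : ℕ) .{{_ : NonZero m}} → ℕ → ℕ → ℕ
floorSum m a n = (a / m) ℕ.* n ℕ.+ (a % m ℕ.+ n ∸ m)

floorSum-zero : ∀ m .{{_ : NonZero m}} a → floorSum m a 0 ≡ 0
floorSum-zero m a = cong₂ ℕ._+_ (*-zeroʳ (a / m))
  (m≤n⇒m∸n≡0 (≤-trans (≤-reflexive (+-identityʳ (a % m))) (m%n≤n a m)))

-- Since `r < m` and `n < m`, the sum `r + n` is below `2m`, so the new floor is `q` or `q + 1`. The
-- extra 1 appears exactly when the excess grows by 1.
floorSum-suc : ∀ m .{{_ : NonZero m}} a n → n < m →
  floorSum m a n ℕ.+ (a ℕ.+ n) / m ≡ floorSum m a (suc n)
floorSum-suc m a n n<m = helper (<-≤-connex (r ℕ.+ n) m)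
  where
  q = a / m
  r = a % m

  swap : ∀ x y z → (x ℕ.+ y) ℕ.+ z ≡ (x ℕ.+ z) ℕ.+ y
  swap = ℕ-Solver.solve-∀

  absorb : ∀ x y z → x ℕ.* y ℕ.+ z ℕ.+ x ≡ x ℕ.* suc y ℕ.+ z
  absorb = ℕ-Solver.solve-∀

  a+n≡[r+n]+qm : a ℕ.+ n ≡ (r ℕ.+ n) ℕ.+ q ℕ.* m
  a+n≡[r+n]+qm = begin
    a ℕ.+ n                   ≡⟨ cong (ℕ._+ n) (m≡m%n+[m/n]*n a m) ⟩
    (r ℕ.+ q ℕ.* m) ℕ.+ n     ≡⟨ swap r (q ℕ.* m) n ⟩
    (r ℕ.+ n) ℕ.+ q ℕ.* m     ∎

  helper : _ → floorSum m a n ℕ.+ (a ℕ.+ n) / m ≡ floorSum m a (suc n)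
  helper (inj₁ r+n<m) = begin
    q ℕ.* n ℕ.+ (r ℕ.+ n ∸ m) ℕ.+ (a ℕ.+ n) / m
      ≡⟨ cong₂ (λ x y → q ℕ.* n ℕ.+ x ℕ.+ y) (m≤n⇒m∸n≡0 (<⇒≤ r+n<m))
           (trans (cong (_/ m) a+n≡[r+n]+qm) ([m+kn]/n≡k q m r+n<m)) ⟩
    q ℕ.* n ℕ.+ 0 ℕ.+ q
      ≡⟨ absorb q n 0 ⟩
    q ℕ.* suc n ℕ.+ 0
      -- The new excess is still 0, even in the boundary case `r + suc n = m`.
      ≡⟨ cong (q ℕ.* suc n ℕ.+_) (m≤n⇒m∸n≡0 (≤-trans (≤-reflexive (+-suc r n)) r+n<m)) ⟨
    floorSum m a (suc n) ∎
  helper (inj₂ m≤r+n) = begin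
    q ℕ.* n ℕ.+ e ℕ.+ (a ℕ.+ n) / m
      ≡⟨ cong (λ x → q ℕ.* n ℕ.+ e ℕ.+ x)
           (trans (cong (_/ m) a+n≡e+[1+q]m) ([m+kn]/n≡k (suc q) m e<m)) ⟩
    q ℕ.* n ℕ.+ e ℕ.+ suc q
      ≡⟨ trans (+-suc (q ℕ.* n ℕ.+ e) q) (trans (cong suc (absorb q n e)) (sym (+-suc (q ℕ.* suc n) e))) ⟩
    q ℕ.* suc n ℕ.+ suc e
      -- As `m ≤ r + n`, nothing is truncated and the successor passes out of the subtraction.
      ≡⟨ cong (q ℕ.* suc n ℕ.+_) (trans (cong (_∸ m) (+-suc r n)) (+-∸-assoc 1 m≤r+n)) ⟨
    floorSum m a (suc n) ∎
    where
    e = r ℕ.+ n ∸ m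

    e<m : e < m
    e<m = +-cancelʳ-< m e m
      (subst (_< m ℕ.+ m) (sym (m∸n+n≡m m≤r+n)) (+-mono-< (m%n<n a m) n<m))

    a+n≡e+[1+q]m : a ℕ.+ n ≡ e ℕ.+ suc q ℕ.* m
    a+n≡e+[1+q]m = begin
      a ℕ.+ n                     ≡⟨ a+n≡[r+n]+qm ⟩
      (r ℕ.+ n) ℕ.+ q ℕ.* m       ≡⟨ cong (ℕ._+ q ℕ.* m) (m∸n+n≡m m≤r+n) ⟨
      (e ℕ.+ m) ℕ.+ q ℕ.* m       ≡⟨ +-assoc e m (q ℕ.* m) ⟩
      e ℕ.+ suc q ℕ.* m           ∎

-- Both differences are unchanged when the two arguments drop by one, which leaves only the cases
-- with a zero argument.
+[m∸n]≡0⊔[m⊖n] : ∀ m n → + (m ∸ n) ≡ 0ℤ ⊔ (m ⊖ n)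
+[m∸n]≡0⊔[m⊖n] m       zero    = refl
+[m∸n]≡0⊔[m⊖n] zero    (suc n) = refl
+[m∸n]≡0⊔[m⊖n] (suc m) (suc n) = trans (+[m∸n]≡0⊔[m⊖n] m n) (cong (0ℤ ⊔_) (sym (ℤ.[1+m]⊖[1+n]≡m⊖n m n)))

+floorSum : ∀ m .{{_ : NonZero m}} a K → + floorSum m a (suc K) ≡
  + (a / m) * (+ K + 1ℤ) + (0ℤ ⊔ (+ (a % m) + + K - + m + 1ℤ))
+floorSum m a K = cong₂ _+_ linear excess
  where
  r = a % m

  linear : + (a / m ℕ.* suc K) ≡ + (a / m) * (+ K + 1ℤ)
  linear = trans (ℤ.pos-* (a / m) (suc K)) (cong (λ x → + (a / m) * + x) (+-comm 1 K))

  -- `+ suc K` is `1ℤ + + K` by computation, which gives the left side its form.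
  rearrange : ∀ x y z → x + (1ℤ + y) - z ≡ x + y - z + 1ℤ
  rearrange = ℤ-Solver.solve-∀

  excess : + (r ℕ.+ suc K ∸ m) ≡ 0ℤ ⊔ (+ r + + K - + m + 1ℤ)
  excess = begin
    + (r ℕ.+ suc K ∸ m)             ≡⟨ +[m∸n]≡0⊔[m⊖n] (r ℕ.+ suc K) m ⟩
    0ℤ ⊔ ((r ℕ.+ suc K) ⊖ m)        ≡⟨ cong (0ℤ ⊔_) (ℤ.m-n≡m⊖n (r ℕ.+ suc K) m) ⟨
    0ℤ ⊔ (+ r + + suc K - + m)      ≡⟨ cong (0ℤ ⊔_) (rearrange (+ r) (+ K) (+ m)) ⟩
    0ℤ ⊔ (+ r + + K - + m + 1ℤ)     ∎

-- The difference of the three closed forms telescopes to `S`: it starts at 0, and its increment at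
-- `k` is the summand of `S`, because `k / m` is 0 for `k ≤ K < m`.
S≡floorSums : ∀ m .{{_ : NonZero m}} a₁ a₂ K → K < m →
  S m a₁ a₂ K ≡ + floorSum m (a₁ ℕ.+ a₂) (suc K) - + floorSum m a₁ (suc K) - + floorSum m a₂ (suc K)
S≡floorSums m a₁ a₂ K K<m = begin
  S m a₁ a₂ K        ≡⟨ ℤ.+-identityˡ (S m a₁ a₂ K) ⟨
  0ℤ + S m a₁ a₂ K   ≡⟨ cong (_+ S m a₁ a₂ K) F-zero ⟨
  F 0 + S m a₁ a₂ K  ≡⟨ sum-telescope (suc K) F f (λ k k≤K → F-suc k (≤-trans k≤K K<m)) ⟩
  F (suc K)          ∎
  where
  F f : ℕ → ℤ
  F n = + floorSum m (a₁ ℕ.+ a₂) n - + floorSum m a₁ n - + floorSum m a₂ n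
  f k = + ((a₁ ℕ.+ a₂ ℕ.+ k) / m) - + ((a₁ ℕ.+ k) / m) - + ((a₂ ℕ.+ k) / m) + + (k / m)

  F-zero : F 0 ≡ 0ℤ
  F-zero rewrite floorSum-zero m (a₁ ℕ.+ a₂) | floorSum-zero m a₁ | floorSum-zero m a₂ = refl

  regroup : ∀ x y z x′ y′ z′ →
    (x - y - z) + (x′ - y′ - z′ + 0ℤ) ≡ (x + x′) - (y + y′) - (z + z′)
  regroup = ℤ-Solver.solve-∀

  F-suc : ∀ k → k < m → F k + f k ≡ F (suc k)
  F-suc k k<m
    -- After the rewrites each closed form at `suc k` is its value at `k` plus one floor, and `+_`
    -- distributes over that sum by computation, so only a regrouping of integers remains.
    rewrite m<n⇒m/n≡0 k<m
          | sym (floorSum-suc m (a₁ ℕ.+ a₂) k k<m)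
          | sym (floorSum-suc m a₁ k k<m)
          | sym (floorSum-suc m a₂ k k<m)
    = regroup (+ floorSum m (a₁ ℕ.+ a₂) k) (+ floorSum m a₁ k) (+ floorSum m a₂ k)
        (+ ((a₁ ℕ.+ a₂ ℕ.+ k) / m)) (+ ((a₁ ℕ.+ k) / m)) (+ ((a₂ ℕ.+ k) / m))

proposition5 : ∀ (m : ℕ) .{{_ : NonZero m}} (K : ℕ) → K ≤ m ∸ 1 → (a₁ a₂ : ℕ) →
    S m a₁ a₂ K
    ≡ (+ ((a₁ ℕ.+ a₂) / m) - + (a₁ / m) - + (a₂ / m)) * (+ K + 1ℤ)
    + (0ℤ ⊔ (+ ((a₁ ℕ.+ a₂) % m) + + K - + m + 1ℤ))
    - (0ℤ ⊔ (+ (a₁ % m) + + K - + m + 1ℤ))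
    - (0ℤ ⊔ (+ (a₂ % m) + + K - + m + 1ℤ))
-- Exposing the successor lets `m ∸ 1` compute, so that `s≤s` turns the bound into `K < m`.
proposition5 m@(suc _) K K≤m∸1 a₁ a₂ = begin
  S m a₁ a₂ K
    ≡⟨ S≡floorSums m a₁ a₂ K (s≤s K≤m∸1) ⟩
  + floorSum m (a₁ ℕ.+ a₂) (suc K) - + floorSum m a₁ (suc K) - + floorSum m a₂ (suc K)
    ≡⟨ cong₂ _-_ (cong₂ _-_ (+floorSum m (a₁ ℕ.+ a₂) K) (+floorSum m a₁ K)) (+floorSum m a₂ K) ⟩
  (q (a₁ ℕ.+ a₂) * n + e (a₁ ℕ.+ a₂)) - (q a₁ * n + e a₁) - (q a₂ * n + e a₂)
    ≡⟨ collect (q (a₁ ℕ.+ a₂)) (q a₁) (q a₂) n (e (a₁ ℕ.+ a₂)) (e a₁) (e a₂) ⟩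
  (q (a₁ ℕ.+ a₂) - q a₁ - q a₂) * n + e (a₁ ℕ.+ a₂) - e a₁ - e a₂ ∎
  where
  n = + K + 1ℤ

  q e : ℕ → ℤ
  q a = + (a / m)
  e a = 0ℤ ⊔ (+ (a % m) + + K - + m + 1ℤ)

  collect : ∀ x y z t u v w →
    (x * t + u) - (y * t + v) - (z * t + w) ≡ (x - y - z) * t + u - v - w
  collect = ℤ-Solver.solve-∀
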